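{- For a rooted tree $T$ with maximum degree $\Delta$, both the head level and the neck level of $T$ (with respect to $\Delta$) are bounded by $O(\log |V(T)|/\log \Delta)$.
   Context: A $k$-$L(2,1)$-labeling of a graph $G$ is a map $f:V(G)\to\{0,1,\ldots,k\}$ with $|f(x)-f(y)|\ge 2$ whenever $x,y$ are adjacent and $|f(x)-f(y)|\ge 1$ whenever $x,y$ are at distance $2$. For integers $h\ge 0$ let $L_h=\{h,h+1,\ldots,\Delta-h+1\}$. For a tree $T$ rooted at $v$ and a new vertex $u\notin V(T)$, let $T+(u,v)$ be $T$ with the added vertex $u$ and edge $(u,v)$; for labels $a,b$ set $\delta((u,v),(a,b))=1$ if $T+(u,v)$ has a $(\Delta+1)$-$L(2,1)$-labeling $f$ with $f(u)=a$, $f(v)=b$, and $0$ otherwise. $T$ is head-$L_h$-compatible if $\delta((u,v),(a,b))=\delta((u,v),(a',b))$ for all $a,a'\in L_h$, $b\in L_0$ with $|a-b|\ge2$, $|a'-b|\ge2$; neck-$L_h$-compatible if $\delta((u,v),(a,b))=\delta((u,v),(a,b'))$ for all $a\in L_0$, $b,b'\in L_h$ with $|a-b|\ge2$, $|a-b'|\ge2$. The neck (resp. head) level of $T$ is $0$ if $T$ is neck- (resp. head-) $L_0$-compatible, and is $h\ge 1$ if $T$ is not neck- (resp. head-) $L_{h-1}$-compatible but is neck- (resp. head-) $L_h$-compatible. -}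

module Defs where

open import Data.Nat using (ℕ; zero; suc; _+_; _∸_; _≤_; ∣_-_∣)
open import Data.List using (List; []; _∷_; length; lookup)
open import Data.Fin using (Fin)
open import Data.Product using (Σ; _×_; ∃)
open import Data.Sum using (_⊎_)
open import Relation.Binary.PropositionalEquality using (_≡_; _≢_)
open import Relation.Nullary using (¬_)
open import Function.Bundles using (_⇔_)

data Tree : Set where
  node : List Tree → Tree

data Pos : Tree → Set where
  here : ∀ {ts} → Pos (node ts)
  into : ∀ {ts} (i : Fin (length ts)) → Pos (lookup ts i) → Pos (node ts)

mutual
  size : Tree → ℕ
  size (node ts) = suc (sizes ts)

  sizes : List Tree → ℕ
  sizes []       = 0
  sizes (t ∷ ts) = size t + sizes ts

root : (t : Tree) → Pos t
root (node ts) = here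

data Child : {t : Tree} → Pos t → Pos t → Set where
  top    : ∀ {ts} (i : Fin (length ts)) → Child (here {ts}) (into i (root (lookup ts i)))
  deeper : ∀ {ts} (i : Fin (length ts)) {p q : Pos (lookup ts i)} →
           Child p q → Child (into {ts} i p) (into i q)

Adj : {t : Tree} → Pos t → Pos t → Set
Adj p q = Child p q ⊎ Child q p

Dist2 : {t : Tree} → Pos t → Pos t → Set
Dist2 {t} p q = p ≢ q × ¬ Adj p q × Σ (Pos t) (λ w → Adj p w × Adj w q)

arity : {t : Tree} → Pos t → ℕ
arity (here {ts}) = length ts
arity (into i p)  = arity p

-- Degree in the underlying undirected tree (children, plus the parent if not the root).
deg : {t : Tree} → Pos t → ℕ
deg (here {ts})  = length ts
deg (into i p)   = suc (arity p)

MaxDegree : Tree → ℕ → Set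
MaxDegree t Δ = (∀ (p : Pos t) → deg p ≤ Δ) × Σ (Pos t) (λ p → deg p ≡ Δ)

IsL21 : {t : Tree} → ℕ → (Pos t → ℕ) → Set
IsL21 {t} k f =
  (∀ p → f p ≤ k) ×
  (∀ p q → Adj p q → 2 ≤ ∣ f p - f q ∣) ×
  (∀ p q → Dist2 p q → f p ≢ f q)

plus : Tree → Tree
plus (node ts) = node (node [] ∷ ts)

vertexV : (t : Tree) → Pos (plus t)
vertexV (node ts) = here

vertexU : (t : Tree) → Pos (plus t)
vertexU (node ts) = into Fin.zero here

-- δ((u,v),(a,b)) = 1  (as a proposition)
δ : ℕ → Tree → ℕ → ℕ → Set
δ Δ t a b = Σ (Pos (plus t) → ℕ) λ f →
  IsL21 (suc Δ) f × f (vertexU t) ≡ a × f (vertexV t) ≡ b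

InL : ℕ → ℕ → ℕ → Set
InL Δ h a = h ≤ a × a ≤ suc Δ ∸ h

HeadCompat : ℕ → Tree → ℕ → Set
HeadCompat Δ t h = ∀ a a' b → InL Δ h a → InL Δ h a' → InL Δ 0 b →
  2 ≤ ∣ a - b ∣ → 2 ≤ ∣ a' - b ∣ → δ Δ t a b ⇔ δ Δ t a' b

NeckCompat : ℕ → Tree → ℕ → Set
NeckCompat Δ t h = ∀ a b b' → InL Δ 0 a → InL Δ h b → InL Δ h b' →
  2 ≤ ∣ a - b ∣ → 2 ≤ ∣ a - b' ∣ → δ Δ t a b ⇔ δ Δ t a b'

HeadLevel : ℕ → Tree → ℕ → Set
HeadLevel Δ t zero    = HeadCompat Δ t 0
HeadLevel Δ t (suc h) = ¬ HeadCompat Δ t h × HeadCompat Δ t (suc h)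

NeckLevel : ℕ → Tree → ℕ → Set
NeckLevel Δ t zero    = NeckCompat Δ t 0
NeckLevel Δ t (suc h) = ¬ NeckCompat Δ t h × NeckCompat Δ t (suc h)

{-# OPTIONS --safe #-}

-- Labelings of T + (u,v) are rebuilt branch by branch. Call a branch light if its size is below
-- M^(j-1); a tree with fewer than M^j vertices has fewer than M heavy branches at its root.
-- To move the neck label from b ∈ L_h to b′ ∈ L_{h+1} (h = 2j), first clear the labels b′-1, b′, b′+1
-- of heavy branches: such a branch trades its label with a label of L_{h+1} used by no heavy branch,
-- which exists as soon as |L_{h+1}| exceeds M by a constant. The branches still labelled near b′ are
-- light, hence by induction flexible on the wider range L_{h-1}, and are reflected to labels near b.
-- Head labels are moved in the same way. So size < M^j forces levels at most 2j + 1, and L_h ≠ ∅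
-- leaves enough room to take M ≥ √Δ with j proportional to h.
module Submission where

open import Defs
open import Data.Nat using (ℕ; zero; suc; pred; _+_; _*_; _∸_; _^_; _/_; _≤_; _<_; ∣_-_∣; s≤s; s≤s⁻¹; z≤n; _≤?_; _<?_; NonZero; >-nonZero)
open import Data.Nat.Properties
open import Data.Nat.DivMod using (m≡m%n+[m/n]*n; m%n<n)
open import Data.Nat.Tactic.RingSolver using (solve-∀)
open import Data.Fin using (Fin; zero; suc; toℕ)
import Data.Fin.Properties as Fin
open import Data.List using (List; []; _∷_; _++_; length; lookup)
open import Data.List.Properties using (length-++)
open import Data.List.Membership.Propositional using (_∈_; _∉_)
open import Data.List.Membership.Propositional.Properties using (∈-++⁺ˡ; ∈-++⁺ʳ)
open import Data.List.Membership.DecPropositional _≟_ using (_∈?_)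
open import Data.List.Relation.Unary.Any as Any using (here; there)
open import Data.List.Relation.Unary.Any.Properties using (lookup-index)
open import Data.Product using (Σ; _×_; _,_; proj₁; proj₂; ∃)
open import Data.Sum using (_⊎_; inj₁; inj₂)
open import Data.Empty using (⊥-elim)
open import Function.Base using (_∘_)
open import Function.Bundles using (mk⇔)
open import Function.Definitions using (Injective)
open import Relation.Binary.PropositionalEquality
open import Relation.Nullary using (¬_; Dec; yes; no; decidable-stable; ¬?)

private variable
  Δ k a b x y : ℕ
  t : Tree
  ts : List Tree

-- Labelings as a recursive relation on rooted trees

tree-induction : (P : Tree → Set) →
  (∀ ts → (∀ i → P (lookup ts i)) → P (node ts)) → ∀ t → P t
tree-induction P step = go
  where
  -- `lookup ts i` is not visibly a subterm, so `goAll` walks down the list to make the recursion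
  -- structural.
  go : ∀ t → P t
  goAll : ∀ ts (i : Fin (length ts)) → P (lookup ts i)
  go (node ts) = step ts (goAll ts)
  goAll (t ∷ ts) zero    = go t
  goAll (t ∷ ts) (suc i) = goAll ts i

-- Ext k t a b: t extends to a labelling with root label b below a parent labelled a.
-- Label distinctness at distance 2 becomes injectivity among the children together with avoidance of a.
data Ext (k : ℕ) : Tree → ℕ → ℕ → Set where
  ext : ∀ {ts a b} (ℓ : Fin (length ts) → ℕ) → a ≤ k → b ≤ k → 2 ≤ ∣ a - b ∣ →
        Injective _≡_ _≡_ ℓ → (∀ i → ℓ i ≢ a) →
        (∀ i → Ext k (lookup ts i) b (ℓ i)) → Ext k (node ts) a b

Ext-bound : Ext k t a b → b ≤ k
Ext-bound (ext _ _ b≤k _ _ _ _) = b≤k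

Ext-apart : Ext k t a b → 2 ≤ ∣ a - b ∣
Ext-apart (ext _ _ _ apart _ _ _) = apart

-- A path of length two in a rooted tree either descends twice or turns at a common parent, so the
-- condition at distance two splits into `grandparent` and `siblings`.
record Local (k : ℕ) {t : Tree} (f : Pos t → ℕ) : Set where
  field
    bounded     : ∀ p → f p ≤ k
    edge        : ∀ {p q} → Child p q → 2 ≤ ∣ f p - f q ∣
    grandparent : ∀ {p w q} → Child p w → Child w q → f p ≢ f q
    siblings    : ∀ {w p q} → Child w p → Child w q → p ≢ q → f p ≢ f q

depth : Pos t → ℕ
depth here       = 0
depth (into i p) = suc (depth p)

depth-root : ∀ t → depth (root t) ≡ 0
depth-root (node ts) = refl

depth-child : {p q : Pos t} → Child p q → depth q ≡ suc (depth p)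
depth-child (top {ts} i)   = cong suc (depth-root (lookup ts i))
depth-child (deeper i c) = cong suc (depth-child c)

-- Depth rules out the mixed cases: a child of the root has depth 1, a child of any other vertex at
-- least 2.
parent-unique : {p q w w′ : Pos t} → Child p w → Child q w′ → w ≡ w′ → p ≡ q
parent-unique (top i) (top j) eq = refl
parent-unique (top {ts} i) (deeper j c) eq
  with () ← trans (sym (cong suc (depth-root (lookup ts i)))) (trans (cong depth eq) (cong suc (depth-child c)))
parent-unique (deeper i c) (top {ts} j) eq
  with () ← trans (sym (cong suc (depth-root (lookup ts j)))) (trans (cong depth (sym eq)) (cong suc (depth-child c)))
parent-unique (deeper i c) (deeper .i c′) refl = cong (into i) (parent-unique c c′ refl)

siblings-dist2 : {w p q : Pos t} → Child w p → Child w q → p ≢ q → Dist2 p q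
siblings-dist2 {w = w} {p} {q} wp wq p≢q = p≢q , ¬adj , w , inj₂ wp , inj₁ wq
  where
  same : depth p ≡ depth q
  same = trans (depth-child wp) (sym (depth-child wq))
  ¬adj : ¬ Adj p q
  ¬adj (inj₁ pq) = 1+n≢n (trans (sym (depth-child pq)) (sym same))
  ¬adj (inj₂ qp) = 1+n≢n (trans (sym (depth-child qp)) same)

grandparent-dist2 : {p w q : Pos t} → Child p w → Child w q → Dist2 p q
grandparent-dist2 {p = p} {w} {q} pw wq =
  (λ p≡q → m≢1+m+n _ {1} (trans (cong depth p≡q) (trans two (cong suc (+-comm 1 _))))) , ¬adj , w , inj₁ pw , inj₁ wq
  where
  two : depth q ≡ 2 + depth p
  two = trans (depth-child wq) (cong suc (depth-child pw))
  ¬adj : ¬ Adj p q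
  ¬adj (inj₁ pq) = 1+n≢n (suc-injective (trans (sym two) (depth-child pq)))
  ¬adj (inj₂ qp) = m≢1+m+n _ {2} (trans (depth-child qp) (trans (cong suc two) (cong suc (+-comm 2 _))))

IsL21⇒Local : {f : Pos t → ℕ} → IsL21 k f → Local k f
IsL21⇒Local (bounded , adjacent , dist2) = record
  { bounded     = bounded
  ; edge        = λ c → adjacent _ _ (inj₁ c)
  ; grandparent = λ c d → dist2 _ _ (grandparent-dist2 c d)
  ; siblings    = λ c d p≢q → dist2 _ _ (siblings-dist2 c d p≢q)
  }

Local⇒IsL21 : {f : Pos t → ℕ} → Local k f → IsL21 k f
Local⇒IsL21 {f = f} loc = bounded , adjacent , dist2
  where
  open Local loc
  adjacent : ∀ p q → Adj p q → 2 ≤ ∣ f p - f q ∣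
  adjacent p q (inj₁ c) = edge c
  adjacent p q (inj₂ c) = subst (2 ≤_) (∣-∣-comm (f q) (f p)) (edge c)
  dist2 : ∀ p q → Dist2 p q → f p ≢ f q
  dist2 p q (_   , _ , w , inj₁ pw , inj₁ wq) = grandparent pw wq
  dist2 p q (p≢q , _ , w , inj₁ pw , inj₂ qw) = ⊥-elim (p≢q (parent-unique pw qw refl))
  dist2 p q (p≢q , _ , w , inj₂ wp , inj₁ wq) = siblings wp wq p≢q
  dist2 p q (_   , _ , w , inj₂ wp , inj₂ qw) = grandparent qw wp ∘ sym

Local-into : {f : Pos (node ts) → ℕ} → Local k f → ∀ i → Local k (f ∘ into i)
Local-into loc i = record
  { bounded     = bounded ∘ into i
  ; edge        = edge ∘ deeper i
  ; grandparent = λ c d → grandparent (deeper i c) (deeper i d)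
  ; siblings    = λ c d p≢q → siblings (deeper i c) (deeper i d) (p≢q ∘ into-injective)
  }
  where
  open Local loc
  into-injective : ∀ {p q} → into i p ≡ into i q → p ≡ q
  into-injective refl = refl

into-index : ∀ {i j} {p : Pos (lookup ts i)} {q : Pos (lookup ts j)} → into {ts} i p ≡ into j q → i ≡ j
into-index refl = refl

Local⇒Ext : ∀ t {a} {f : Pos t → ℕ} → Local k f → a ≤ k → 2 ≤ ∣ a - f (root t) ∣ →
  (∀ {q} → Child (root t) q → f q ≢ a) → Ext k t a (f (root t))
Local⇒Ext {k} = tree-induction _ step
  where
  step : ∀ ts →
    (∀ i {a} {f : Pos (lookup ts i) → ℕ} → Local k f → a ≤ k → 2 ≤ ∣ a - f (root (lookup ts i)) ∣ →
      (∀ {q} → Child (root (lookup ts i)) q → f q ≢ a) → Ext k (lookup ts i) a (f (root (lookup ts i)))) →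
    ∀ {a} {f : Pos (node ts) → ℕ} → Local k f → a ≤ k → 2 ≤ ∣ a - f here ∣ →
      (∀ {q} → Child here q → f q ≢ a) → Ext k (node ts) a (f here)
  step ts rec {a} {f} loc a≤k apart avoid =
    ext (λ i → f (into i (root _))) a≤k (bounded here) apart injective (avoid ∘ top)
      (λ i → rec i (Local-into loc i) (bounded here) (edge (top i)) (λ c → grandparent (top i) (deeper i c) ∘ sym))
    where
    open Local loc
    injective : Injective _≡_ _≡_ (λ i → f (into i (root _)))
    injective {i} {j} eq with i Fin.≟ j
    ... | yes i≡j = i≡j
    ... | no  i≢j = ⊥-elim (siblings (top i) (top j) (i≢j ∘ into-index) eq)

-- In `plus t` the new vertex u is a child of v, while `Ext` treats it as the parent. The
-- constraints agree: all neighbours of v carry distinct labels far from that of v, whichever of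
-- them counts as its parent.
δ⇒Ext : ∀ {Δ} t → δ Δ t a b → Ext (suc Δ) t a b
δ⇒Ext (node ts) (f , l21 , refl , refl) =
  ext (λ i → f (into (suc i) (root _))) (bounded _) (bounded _)
    (subst (2 ≤_) (∣-∣-comm (f here) _) (edge (top zero)))
    injective (λ i → siblings (top (suc i)) (top zero) ((λ ()) ∘ into-index))
    (λ i → Local⇒Ext (lookup ts i) (Local-into loc (suc i)) (bounded here) (edge (top (suc i)))
             (λ c → grandparent (top (suc i)) (deeper (suc i) c) ∘ sym))
  where
  loc = IsL21⇒Local l21
  open Local loc
  injective : Injective _≡_ _≡_ (λ i → f (into (suc i) (root _)))
  injective {i} {j} eq with i Fin.≟ j
  ... | yes i≡j = i≡j
  ... | no  i≢j = ⊥-elim (siblings (top (suc i)) (top (suc j)) (i≢j ∘ Fin.suc-injective ∘ into-index) eq)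

glue : ℕ → (∀ i → Pos (lookup ts i) → ℕ) → Pos (node ts) → ℕ
glue b fs here       = b
glue b fs (into i p) = fs i p

Local-glue : {fs : ∀ i → Pos (lookup ts i) → ℕ} → b ≤ k → (∀ i → Local k (fs i)) →
  (∀ i → 2 ≤ ∣ b - fs i (root _) ∣) → Injective _≡_ _≡_ (λ i → fs i (root _)) →
  (∀ i {q} → Child (root (lookup ts i)) q → fs i q ≢ b) → Local k (glue {ts} b fs)
Local-glue {ts} {b} {k} {fs} b≤k locals apart injective avoid = record
  { bounded = λ { here → b≤k ; (into i p) → Local.bounded (locals i) p }
  ; edge = λ { (top i) → apart i ; (deeper i c) → Local.edge (locals i) c }
  ; grandparent = grand
  ; siblings = sib
  }
  where
  f = glue {ts} b fs
  grand : ∀ {p w q} → Child p w → Child w q → f p ≢ f q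
  grand (top i)      (deeper .i d) = avoid i d ∘ sym
  grand (deeper i c) (deeper .i d) = Local.grandparent (locals i) c d
  sib : ∀ {w p q} → Child w p → Child w q → p ≢ q → f p ≢ f q
  sib (top i)      (top j)       p≢q eq = p≢q (cong (λ i → into i (root _)) (injective eq))
  sib (deeper i c) (deeper .i d) p≢q    = Local.siblings (locals i) c d (p≢q ∘ cong (into i))

labelling : Ext k t a b → Pos t → ℕ
labelling (ext {b = b} _ _ _ _ _ _ es) = glue b (λ i → labelling (es i))

labelling-root : (e : Ext k t a b) → labelling e (root t) ≡ b
labelling-root (ext _ _ _ _ _ _ _) = refl

labelling-child : (e : Ext k t a b) → ∀ {q} → Child (root t) q → labelling e q ≢ a
labelling-child (ext _ _ _ _ _ avoid es) (top i) eq = avoid i (trans (sym (labelling-root (es i))) eq)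

Local-branches : {m : Fin (length ts) → ℕ} → b ≤ k → Injective _≡_ _≡_ m →
  (es : ∀ i → Ext k (lookup ts i) b (m i)) → (∀ i → Local k (labelling (es i))) →
  Local k (glue {ts} b (λ i → labelling (es i)))
Local-branches {b = b} b≤k injective es locals = Local-glue b≤k locals
  (λ i → subst (λ x → 2 ≤ ∣ b - x ∣) (sym (labelling-root (es i))) (Ext-apart (es i)))
  (λ {i} {j} eq → injective (trans (sym (labelling-root (es i))) (trans eq (labelling-root (es j)))))
  (λ i → labelling-child (es i))

Local-labelling : (e : Ext k t a b) → Local k (labelling e)
Local-labelling (ext _ _ b≤k _ injective _ es) =
  Local-branches b≤k injective es (λ i → Local-labelling (es i))

Ext⇒δ : ∀ {Δ} t → Ext (suc Δ) t a b → δ Δ t a b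
Ext⇒δ {a} {b} {Δ} (node ts) (ext ℓ a≤k b≤k apart injective avoid es) =
  _ , Local⇒IsL21 (Local-branches b≤k labels-injective branches (λ i → Local-labelling (branches i))) , refl , refl
  where
  labels : Fin (suc (length ts)) → ℕ
  labels zero    = a
  labels (suc i) = ℓ i
  labels-injective : Injective _≡_ _≡_ labels
  labels-injective {zero}  {zero}  eq = refl
  labels-injective {zero}  {suc j} eq = ⊥-elim (avoid j (sym eq))
  labels-injective {suc i} {zero}  eq = ⊥-elim (avoid i eq)
  labels-injective {suc i} {suc j} eq = cong suc (injective eq)
  branches : ∀ i → Ext (suc Δ) (lookup (node [] ∷ ts) i) b (labels i)
  branches zero    = ext (λ ()) b≤k a≤k (subst (2 ≤_) (∣-∣-comm a b) apart) (λ { {()} }) (λ ()) (λ ())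
  branches (suc i) = es i

-- Label intervals, neighbourhoods and fresh labels

InL⇒+≤ : InL Δ k x → k + x ≤ suc Δ
InL⇒+≤ {Δ} {k} {x} (k≤x , x≤) with k ≤? suc Δ
... | yes k≤ = subst (_≤ suc Δ) (+-comm x k) (m≤o∸n⇒m+n≤o x k≤ x≤)
... | no  k≰ = ⊥-elim (k≰ (≤-trans k≤x (≤-trans x≤ (m∸n≤m (suc Δ) k))))

+≤⇒InL : k ≤ x → k + x ≤ suc Δ → InL Δ k x
+≤⇒InL {k} {x} {Δ} k≤x k+x≤ = k≤x , m+n≤o⇒m≤o∸n x (subst (_≤ suc Δ) (+-comm k x) k+x≤)

InL-antitone : ∀ {k′} → k ≤ k′ → InL Δ k′ x → InL Δ k x
InL-antitone {Δ = Δ} k≤k′ (lo , hi) = ≤-trans k≤k′ lo , ≤-trans hi (∸-monoʳ-≤ (suc Δ) k≤k′)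

InL⇒≤ : InL Δ k x → x ≤ suc Δ
InL⇒≤ {Δ} {k} (_ , hi) = ≤-trans hi (m∸n≤m (suc Δ) k)

Near : ℕ → ℕ → Set
Near b y = ∣ b - y ∣ < 2

InL-near : InL Δ (suc k) b → Near b y → InL Δ k y
InL-near {Δ} {k} {b} {y} b∈ (s≤s near) = +≤⇒InL
  (s≤s⁻¹ (≤-trans (proj₁ b∈) (≤-trans (m≤n+∣m-n∣ b y) (subst (y + ∣ b - y ∣ ≤_) (+-comm y 1) (+-monoʳ-≤ y near)))))
  (≤-trans (+-monoʳ-≤ k (≤-trans (m≤n+∣n-m∣ y b) (subst (b + ∣ b - y ∣ ≤_) (+-comm b 1) (+-monoʳ-≤ b near))))
    (subst (_≤ suc Δ) (sym (+-suc k b)) (InL⇒+≤ b∈)))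

near-refl : ∀ b → Near b b
near-refl b = subst (_< 2) (sym (∣n-n∣≡0 b)) (s≤s z≤n)

near-suc : ∀ b → Near b (suc b)
near-suc zero    = ≤-refl
near-suc (suc b) = near-suc b

near-pred : ∀ b → Near b (pred b)
near-pred zero    = s≤s z≤n
near-pred (suc b) = subst (_< 2) (∣-∣-comm b (suc b)) (near-suc b)

-- There are always three entries, also at b = 0 where `pred` repeats 0; the counts of forbidden
-- labels rely on this length.
neighbourhood : ℕ → List ℕ
neighbourhood b = pred b ∷ b ∷ suc b ∷ []

near⇒∈ : ∀ b y → Near b y → y ∈ neighbourhood b
near⇒∈ zero zero near = here refl
near⇒∈ zero (suc zero) near = there (there (here refl))
near⇒∈ zero (suc (suc y)) (s≤s (s≤s ()))
near⇒∈ (suc zero) zero near = here refl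
near⇒∈ (suc (suc b)) zero (s≤s (s≤s ()))
near⇒∈ (suc b) (suc y) near with near⇒∈ b y near
... | there (here eq) = there (here (cong suc eq))
... | there (there (here eq)) = there (there (here (cong suc eq)))
... | here eq with b
...   | zero  = there (here (cong suc eq))
...   | suc _ = here (cong suc eq)

∉⇒apart : ∀ {xs} → y ∉ neighbourhood b ++ xs → 2 ≤ ∣ b - y ∣
∉⇒apart {y} {b} y∉ = ≮⇒≥ (y∉ ∘ ∈-++⁺ˡ ∘ near⇒∈ b y)

-- Were all n consecutive labels in `xs`, two of them would share an index of `xs` by pigeonhole and
-- so coincide.
fresh : ∀ lo n (xs : List ℕ) → length xs < n → ∃ λ z → lo ≤ z × z < lo + n × z ∉ xs
fresh lo n xs len< with Fin.any? (λ i → ¬? (lo + toℕ {n} i ∈? xs))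
... | yes (i , ∉xs) = lo + toℕ i , m≤m+n lo _ , +-monoʳ-< lo (Fin.toℕ<n i) , ∉xs
... | no none = ⊥-elim (collision (Fin.pigeonhole len< (Any.index ∘ all∈)))
  where
  all∈ : ∀ i → lo + toℕ {n} i ∈ xs
  all∈ i = decidable-stable (_ ∈? xs) (λ ∉xs → none (i , ∉xs))
  collision : ¬ (∃ λ i → ∃ λ j → toℕ i < toℕ j × Any.index (all∈ i) ≡ Any.index (all∈ j))
  collision (i , j , i<j , eq) = <⇒≢ i<j (+-cancelˡ-≡ lo _ _
    (trans (lookup-index (all∈ i)) (trans (cong (lookup xs) eq) (sym (lookup-index (all∈ j))))))

-- Heavy branches and transpositions of labels

heavyLabels : ℕ → ∀ ts → (Fin (length ts) → ℕ) → List ℕ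
heavyLabels F []       ℓ = []
heavyLabels F (t ∷ ts) ℓ with F ≤? size t
... | yes _ = ℓ zero ∷ heavyLabels F ts (ℓ ∘ suc)
... | no  _ = heavyLabels F ts (ℓ ∘ suc)

-- Each heavy branch accounts for at least F vertices, and the branches are disjoint.
length-heavyLabels : ∀ F ts ℓ → length (heavyLabels F ts ℓ) * F ≤ sizes ts
length-heavyLabels F []       ℓ = z≤n
length-heavyLabels F (t ∷ ts) ℓ with F ≤? size t
... | yes F≤ = +-mono-≤ F≤ (length-heavyLabels F ts (ℓ ∘ suc))
... | no  _  = ≤-trans (length-heavyLabels F ts (ℓ ∘ suc)) (m≤n+m _ (size t))

∈-heavyLabels : ∀ F ts ℓ i → F ≤ size (lookup ts i) → ℓ i ∈ heavyLabels F ts ℓ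
∈-heavyLabels F (t ∷ ts) ℓ i F≤ with F ≤? size t | i
... | yes _  | zero  = here refl
... | yes _  | suc i = there (∈-heavyLabels F ts (ℓ ∘ suc) i F≤)
... | no F≰  | zero  = ⊥-elim (F≰ F≤)
... | no _   | suc i = ∈-heavyLabels F ts (ℓ ∘ suc) i F≤

swap : ℕ → ℕ → ℕ → ℕ
swap x z y with y ≟ x | y ≟ z
... | yes _ | _     = z
... | no _  | yes _ = x
... | no _  | no _  = y

data SwapView (x z y : ℕ) : ℕ → Set where
  left  : y ≡ x → SwapView x z y z
  right : y ≡ z → SwapView x z y x
  fixed : y ≢ x → y ≢ z → SwapView x z y y

swap-view : ∀ x z y → SwapView x z y (swap x z y)
swap-view x z y with y ≟ x | y ≟ z
... | yes y≡x | _       = left y≡x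
... | no _    | yes y≡z = right y≡z
... | no y≢x  | no y≢z  = fixed y≢x y≢z

swap-involutive : ∀ x z y → swap x z (swap x z y) ≡ y
swap-involutive x z y with swap x z y | swap-view x z y
... | _ | left refl with swap x z z | swap-view x z z
...   | _ | left z≡x   = z≡x
...   | _ | right _    = refl
...   | _ | fixed _ ne = ⊥-elim (ne refl)
swap-involutive x z y | _ | right refl with swap x z x | swap-view x z x
...   | _ | left _     = refl
...   | _ | right x≡z  = x≡z
...   | _ | fixed ne _ = ⊥-elim (ne refl)
swap-involutive x z y | _ | fixed y≢x y≢z with swap x z y | swap-view x z y
...   | _ | left y≡x  = ⊥-elim (y≢x y≡x)
...   | _ | right y≡z = ⊥-elim (y≢z y≡z)
...   | _ | fixed _ _ = refl

swap-injective : ∀ x z → Injective _≡_ _≡_ (swap x z)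
swap-injective x z {y} {y′} eq =
  trans (sym (swap-involutive x z y)) (trans (cong (swap x z) eq) (swap-involutive x z y′))

-- Relabelling the branches at the root

-- One-sided compatibility with a loss of one level. The loss is what lets the induction close:
-- the labels within distance 1 of a target in L_{h+1} still lie in L_h.
WeakNeck WeakHead : ℕ → ℕ → Tree → Set
WeakNeck Δ h t = ∀ {a b b′} → InL Δ h b → InL Δ (suc h) b′ → 2 ≤ ∣ a - b′ ∣ →
  Ext (suc Δ) t a b → Ext (suc Δ) t a b′
WeakHead Δ h t = ∀ {a a′ b} → InL Δ h a → InL Δ (suc h) a′ → 2 ≤ ∣ a′ - b ∣ →
  Ext (suc Δ) t a b → Ext (suc Δ) t a′ b

-- The inductive step at one root. All branches are flexible at level 2 + g, the light ones already
-- at level g. With h = 2 + g, L_{h+1} has Δ - 2h labels, so `room` leaves M of them for heavy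
-- branches and 7 for other forbidden labels.
module Relabelling
  (Δ g M F : ℕ) (ts : List Tree)
  (room : M + 7 + 2 * (2 + g) ≤ Δ)
  (heavy<M : ∀ ℓ → length (heavyLabels F ts ℓ) < M)
  (neck : ∀ i → WeakNeck Δ (2 + g) (lookup ts i))
  (head : ∀ i → WeakHead Δ (2 + g) (lookup ts i))
  (neck-light : ∀ i → size (lookup ts i) < F → WeakNeck Δ g (lookup ts i))
  where

  private h = 2 + g

  record Labels (a b : ℕ) : Set where
    field
      ℓ         : Fin (length ts) → ℕ
      injective : Injective _≡_ _≡_ ℓ
      avoids    : ∀ i → ℓ i ≢ a
      extends   : ∀ i → Ext (suc Δ) (lookup ts i) b (ℓ i)

    apart : ∀ i → 2 ≤ ∣ b - ℓ i ∣
    apart i = Ext-apart (extends i)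

  open Labels

  -- By injectivity at most one branch carries x; if none does, the condition is vacuous.
  Light : ∀ {a b} → Labels a b → ℕ → Set
  Light L x = ∀ i → ℓ L i ≡ x → size (lookup ts i) < F

  fresh-inner : ∀ (xs : List ℕ) ℓ → length xs ≤ 7 →
    ∃ λ z → InL Δ (suc h) z × z ∉ xs ++ heavyLabels F ts ℓ
  fresh-inner xs ℓ len≤ with fresh (suc h) (M + 7) (xs ++ heavyLabels F ts ℓ) len<
    where
    len< : length (xs ++ heavyLabels F ts ℓ) < M + 7
    len< = begin-strict
      length (xs ++ heavyLabels F ts ℓ)          ≡⟨ length-++ xs ⟩
      length xs + length (heavyLabels F ts ℓ)    <⟨ +-mono-≤-< len≤ (heavy<M ℓ) ⟩
      7 + M                                      ≡⟨ +-comm 7 M ⟩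
      M + 7                                      ∎
      where open ≤-Reasoning
  ... | z , lo≤z , z<hi , z∉ = z , +≤⇒InL lo≤z bound , z∉
    where
    lemma : ∀ m h → suc h + (suc h + m) ≡ suc (suc (m + 2 * h))
    lemma = solve-∀
    bound : suc h + z ≤ suc Δ
    bound = s≤s⁻¹ (begin
      suc (suc h + z)           ≡⟨ +-suc (suc h) z ⟨
      suc h + suc z             ≤⟨ +-monoʳ-≤ (suc h) z<hi ⟩
      suc h + (suc h + (M + 7)) ≡⟨ lemma (M + 7) h ⟩
      2 + (M + 7 + 2 * h)       ≤⟨ s≤s (s≤s room) ⟩
      2 + Δ                     ∎)
      where open ≤-Reasoning

  ∉⇒light : ∀ {xs} ℓ i {z} → z ∉ xs ++ heavyLabels F ts ℓ → ℓ i ≡ z → size (lookup ts i) < F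
  ∉⇒light {xs} ℓ i z∉ refl = ≰⇒> (z∉ ∘ ∈-++⁺ʳ xs ∘ ∈-heavyLabels F ts ℓ i)

  -- The two moves differ in cost. From x to z the target lies in L_{h+1}, and level h suffices for
  -- any branch. Back from z to x the target is only in L_h, so the branch carrying z must be light
  -- and use level g.
  module Exchange {a b x z : ℕ} (L : Labels a b)
    (x∈ : InL Δ h x) (z∈ : InL Δ (suc h) z) (x≢a : x ≢ a) (z≢a : z ≢ a)
    (b-x : 2 ≤ ∣ b - x ∣) (b-z : 2 ≤ ∣ b - z ∣) (light-z : Light L z)
    where

    exchanged : Labels a b
    exchanged = record
      { ℓ = λ i → swap x z (ℓ L i)
      ; injective = λ eq → injective L (swap-injective x z eq)
      ; avoids = λ i → avoids′ i (swap-view x z (ℓ L i))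
      ; extends = λ i → extends′ i (swap-view x z (ℓ L i))
      }
      where
      avoids′ : ∀ i {y} → SwapView x z (ℓ L i) y → y ≢ a
      avoids′ i (left _)    = z≢a
      avoids′ i (right _)   = x≢a
      avoids′ i (fixed _ _) = avoids L i
      extends′ : ∀ i {y} → SwapView x z (ℓ L i) y → Ext (suc Δ) (lookup ts i) b y
      extends′ i (left eq)   = neck i x∈ z∈ b-z (subst (Ext _ _ b) eq (extends L i))
      extends′ i (right eq)  = neck-light i (light-z i eq) (InL-antitone (m≤n+m g 3) z∈)
                                 (InL-antitone (n≤1+n (suc g)) x∈) b-x (subst (Ext _ _ b) eq (extends L i))
      extends′ i (fixed _ _) = extends L i

    light-moved : x ≢ z → Light exchanged x
    light-moved x≢z i eq with swap x z (ℓ L i) | swap-view x z (ℓ L i)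
    ... | _ | left _     = ⊥-elim (x≢z (sym eq))
    ... | _ | right eq′  = light-z i eq′
    ... | _ | fixed ≢x _ = ⊥-elim (≢x eq)

    light-kept : ∀ {y} → y ≢ z → Light L y → Light exchanged y
    light-kept y≢z light i eq with swap x z (ℓ L i) | swap-view x z (ℓ L i)
    ... | _ | left _    = ⊥-elim (y≢z (sym eq))
    ... | _ | right eq′ = light-z i eq′
    ... | _ | fixed _ _ = light i eq

  -- The new label z is chosen outside `keep`, so labels of `keep` that were light before remain so
  -- and several calls can be chained.
  vacate : ∀ {a b x} (keep : List ℕ) → length keep ≤ 3 → InL Δ h x → x ∈ keep → (L : Labels a b) →
    Σ (Labels a b) λ L′ → Light L′ x × (∀ {y} → y ∈ keep → Light L y → Light L′ y)
  vacate {a} {b} {x} keep len≤ x∈ x∈keep L = occupied? (Fin.any? (λ i → ℓ L i ≟ x))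
    where
    Vacated = Σ (Labels a b) λ L′ → Light L′ x × (∀ {y} → y ∈ keep → Light L y → Light L′ y)

    move : ∀ i {z} → ℓ L i ≡ x → InL Δ (suc h) z →
      z ∉ (neighbourhood b ++ a ∷ keep) ++ heavyLabels F ts (ℓ L) → Vacated
    -- Matching x with the label of branch `i₀` yields that x differs from a and is far from b.
    move i₀ {z} refl z∈ z∉ = exchanged , light-moved (∈keep⇒≢z x∈keep) , λ y∈ → light-kept (∈keep⇒≢z y∈)
      where
      ∈keep⇒≢z : ∀ {y} → y ∈ keep → y ≢ z
      ∈keep⇒≢z y∈ refl = z∉ (∈-++⁺ˡ {xs = neighbourhood b ++ a ∷ keep} (there (there (there (there y∈)))))
      open Exchange L x∈ z∈ (avoids L i₀) (λ z≡a → z∉ (there (there (there (here z≡a)))))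
        (apart L i₀) (∉⇒apart z∉) (λ i → ∉⇒light (ℓ L) i z∉)

    occupied? : Dec (∃ λ i → ℓ L i ≡ x) → Vacated
    occupied? (no  none)     = L , (λ i eq → ⊥-elim (none (i , eq))) , λ _ light → light
    occupied? (yes (i , eq)) =
      -- Three labels near b, the label a and at most three labels of `keep`: seven in all.
      let _ , z∈ , z∉ = fresh-inner (neighbourhood b ++ a ∷ keep) (ℓ L) (+-monoʳ-≤ 4 len≤)
      in move i eq z∈ z∉

  -- One round for each label near b′, all of which lie in L_h because b′ is in L_{h+1}. Using the
  -- whole neighbourhood as `keep` protects the earlier rounds.
  vacate-near : ∀ {a b b′} → InL Δ (suc h) b′ → Labels a b →
    Σ (Labels a b) λ L → ∀ i → Near b′ (ℓ L i) → size (lookup ts i) < F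
  vacate-near {a} {b} {b′} b′∈ L₀ =
    let L₁ , light₁ , _     = vacate (neighbourhood b′) ≤-refl (InL-near {Δ} b′∈ (near-pred b′)) first L₀
        L₂ , light₂ , keep₂ = vacate (neighbourhood b′) ≤-refl (InL-near {Δ} b′∈ (near-refl b′)) second L₁
        L₃ , light₃ , keep₃ = vacate (neighbourhood b′) ≤-refl (InL-near {Δ} b′∈ (near-suc b′)) third L₂
    in L₃ , λ i near → all-light L₃ (keep₃ first (keep₂ first light₁)) (keep₃ second light₂) light₃
                         (near⇒∈ b′ (ℓ L₃ i) near) i refl
    where
    first : pred b′ ∈ neighbourhood b′
    first = here refl
    second : b′ ∈ neighbourhood b′
    second = there (here refl)
    third : suc b′ ∈ neighbourhood b′
    third = there (there (here refl))
    all-light : ∀ (L : Labels a b) {y} → Light L (pred b′) → Light L b′ → Light L (suc b′) →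
      y ∈ neighbourhood b′ → Light L y
    all-light L l₁ l₂ l₃ (here refl)                 = l₁
    all-light L l₁ l₂ l₃ (there (here refl))         = l₂
    all-light L l₁ l₂ l₃ (there (there (here refl))) = l₃

  labels : ∀ {a b} → Ext (suc Δ) (node ts) a b → Labels a b
  labels (ext ℓ _ _ _ injective avoids extends) =
    record { ℓ = ℓ ; injective = injective ; avoids = avoids ; extends = extends }

  -- The old head label a becomes free as a′ is taken, so the branch carrying a′, if any, receives
  -- a. Since a is only in L_h, that branch has to be light.
  change-head : ∀ {a a′ b} → InL Δ h a → InL Δ (suc h) a′ → b ≤ suc Δ → 2 ≤ ∣ a - b ∣ → 2 ≤ ∣ a′ - b ∣ →
    (L : Labels a b) → Light L a′ → Ext (suc Δ) (node ts) a′ b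
  change-head {a} {a′} {b} a∈ a′∈ b≤ a-b a′-b L light =
    ext (swap a′ a ∘ ℓ L) (InL⇒≤ {Δ} {suc h} a′∈) b≤ a′-b (injective L ∘ swap-injective a′ a) avoids′ extends′
    where
    a≢a′ : ∀ {i} → ℓ L i ≡ a′ → a ≢ a′
    a≢a′ {i} eq a≡a′ = avoids L i (trans eq (sym a≡a′))
    avoids′ : ∀ i → swap a′ a (ℓ L i) ≢ a′
    avoids′ i with swap a′ a (ℓ L i) | swap-view a′ a (ℓ L i)
    ... | _ | left eq    = a≢a′ eq
    ... | _ | right eq   = ⊥-elim (avoids L i eq)
    ... | _ | fixed ne _ = ne
    extends′ : ∀ i → Ext (suc Δ) (lookup ts i) b (swap a′ a (ℓ L i))
    extends′ i with swap a′ a (ℓ L i) | swap-view a′ a (ℓ L i)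
    ... | _ | left eq   = neck-light i (light i eq)
                            (InL-antitone (≤-trans (n≤1+n _) (≤-trans (n≤1+n _) (n≤1+n _))) a′∈)
                            (InL-antitone (n≤1+n _) a∈)
                            (subst (2 ≤_) (∣-∣-comm a b) a-b) (subst (Ext _ _ b) eq (extends L i))
    ... | _ | right eq  = ⊥-elim (avoids L i eq)
    ... | _ | fixed _ _ = extends L i

  weakHead : WeakHead Δ h (node ts)
  weakHead {a} {a′} {b} a∈ a′∈ a′-b e =
    let L , light , _ = vacate (a′ ∷ []) (s≤s z≤n) (InL-antitone {Δ = Δ} (n≤1+n h) a′∈) (here refl) (labels e)
    in change-head a∈ a′∈ (Ext-bound e) (Ext-apart e) a′-b L light

  -- For the branches the root label is a head label. A branch label far from b′ stays, and only its
  -- head changes. A label near b′ is reflected to one near b; no collision arises, since a and all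
  -- branch labels are far from b.
  change-neck : ∀ {a b b′} → InL Δ h b → InL Δ (suc h) b′ → a ≤ suc Δ → 2 ≤ ∣ a - b ∣ → 2 ≤ ∣ a - b′ ∣ →
    (L : Labels a b) → (∀ i → Near b′ (ℓ L i) → size (lookup ts i) < F) → Ext (suc Δ) (node ts) a b′
  change-neck {a} {b} {b′} b∈ b′∈ a≤ a-b a-b′ L light =
    ext ℓ′ a≤ (InL⇒≤ {Δ} {suc h} b′∈) a-b′ injective′ avoids′ extends′
    where
    -- Reflection about (b + b′)/2 exchanges the neighbourhoods of b and b′.
    ρ : ℕ → ℕ
    ρ y with ∣ b′ - y ∣ <? 2
    ... | yes _ = b + b′ ∸ y
    ... | no  _ = y

    ℓ′ : Fin (length ts) → ℕ
    ℓ′ = ρ ∘ ℓ L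

    -- Ensures that the subtraction in `ρ` is not truncated: y is at most b′ + 1, and b is at least
    -- h, hence positive.
    near-≤ : Near b′ y → y ≤ b + b′
    near-≤ {y} (s≤s near) = begin
      y                  ≤⟨ m≤n+∣n-m∣ y b′ ⟩
      b′ + ∣ b′ - y ∣    ≤⟨ +-monoʳ-≤ b′ near ⟩
      b′ + 1             ≤⟨ +-monoʳ-≤ b′ (≤-trans (s≤s z≤n) (proj₁ b∈)) ⟩
      b′ + b             ≡⟨ +-comm b′ b ⟩
      b + b′             ∎
      where open ≤-Reasoning

    reflect-dist : ∀ b b′ y y′ → y + y′ ≡ b + b′ → ∣ b′ - y′ ∣ ≡ ∣ b - y ∣
    reflect-dist b b′ y y′ sum = begin
      ∣ b′ - y′ ∣               ≡⟨ ∣m+n-m+o∣≡∣n-o∣ b b′ y′ ⟨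
      ∣ b + b′ - b + y′ ∣       ≡⟨ cong ∣_- b + y′ ∣ sum ⟨
      ∣ y + y′ - b + y′ ∣       ≡⟨ cong₂ ∣_-_∣ (+-comm y y′) (+-comm b y′) ⟩
      ∣ y′ + y - y′ + b ∣       ≡⟨ ∣m+n-m+o∣≡∣n-o∣ y′ y b ⟩
      ∣ y - b ∣                 ≡⟨ ∣-∣-comm y b ⟩
      ∣ b - y ∣                 ∎
      where open ≡-Reasoning

    near-sum : Near b′ y → y + (b + b′ ∸ y) ≡ b + b′
    near-sum near = m+[n∸m]≡n (near-≤ near)

    reflect-near : Near b′ y → Near b (b + b′ ∸ y)
    reflect-near {y} near = subst (_< 2)
      (sym (reflect-dist b′ b y _ (trans (near-sum near) (+-comm b b′)))) near

    far : ∀ i → ¬ Near b (ℓ L i)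
    far i near = <⇒≱ near (apart L i)

    a-far : ¬ Near b a
    a-far near = <⇒≱ near (subst (2 ≤_) (∣-∣-comm a b) a-b)

    injective′ : Injective _≡_ _≡_ ℓ′
    injective′ {i} {j} eq with ∣ b′ - ℓ L i ∣ <? 2 | ∣ b′ - ℓ L j ∣ <? 2
    ... | yes ni | yes nj = injective L (∸-cancelˡ-≡ (near-≤ ni) (near-≤ nj) eq)
    ... | yes ni | no  _  = ⊥-elim (far j (subst (Near b) eq (reflect-near ni)))
    ... | no  _  | yes nj = ⊥-elim (far i (subst (Near b) (sym eq) (reflect-near nj)))
    ... | no  _  | no  _  = injective L eq

    avoids′ : ∀ i → ℓ′ i ≢ a
    avoids′ i eq with ∣ b′ - ℓ L i ∣ <? 2
    ... | yes ni = a-far (subst (Near b) eq (reflect-near ni))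
    ... | no  _  = avoids L i eq

    -- The head can only be changed while the neck is far from both b and b′, hence the detour through w.
    reflected : ∀ i → Near b′ (ℓ L i) → Ext (suc Δ) (lookup ts i) b′ (b + b′ ∸ ℓ L i)
    reflected i near =
      let w , w∈ , w∉ = fresh-inner (neighbourhood b ++ neighbourhood b′) (ℓ L) (n≤1+n 6)
      -- As b is only in L_h, a label near it is only known to lie in L_{h-1}, that is L_{g+1}. This
      -- is why each round of the induction costs two levels.
      in neck-light i (light i near) (InL-antitone (m≤n+m g 3) w∈) (InL-near {Δ} b∈ (reflect-near near))
           (subst (2 ≤_) (sym (reflect-dist b b′ (ℓ L i) _ (near-sum near))) (apart L i))
           (head i b∈ b′∈ (∉⇒apart (λ w∈b′ → w∉ (there (there (there w∈b′)))))
             (neck-light i (light i near) (InL-antitone (m≤n+m g 2) (InL-near {Δ} b′∈ near))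
               (InL-antitone (m≤n+m (suc g) 2) w∈) (∉⇒apart w∉) (extends L i)))

    extends′ : ∀ i → Ext (suc Δ) (lookup ts i) b′ (ℓ′ i)
    extends′ i with ∣ b′ - ℓ L i ∣ <? 2
    ... | yes near = reflected i near
    ... | no  ¬near = head i b∈ b′∈ (≮⇒≥ ¬near) (extends L i)

  weakNeck : WeakNeck Δ h (node ts)
  weakNeck {a} {b} {b′} b∈ b′∈ a-b′ e@(ext _ a≤ _ _ _ _ _) =
    let L , light = vacate-near b′∈ (labels e)
    in change-neck b∈ b′∈ a≤ (Ext-apart e) a-b′ L light

-- Induction on the exponent

size-lookup : ∀ ts i → size (lookup ts i) ≤ sizes ts
size-lookup (t ∷ ts) zero    = m≤m+n (size t) (sizes ts)
size-lookup (t ∷ ts) (suc i) = ≤-trans (size-lookup ts i) (m≤n+m (sizes ts) (size t))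

-- Double induction: the outer one on j makes branches below M^j flexible two levels lower, the
-- inner one on the tree gives all branches flexibility at the current level.
small⇒weak : ∀ j {Δ M} → M + 7 + 2 * (2 * j) ≤ Δ → ∀ t → size t < M ^ j →
  WeakNeck Δ (2 * j) t × WeakHead Δ (2 * j) t
small⇒weak zero room (node ts) (s≤s ())
small⇒weak (suc j) {Δ} {M} room₁ =
  subst (λ h → ∀ t → size t < M ^ suc j → WeakNeck Δ h t × WeakHead Δ h t) (sym (*-suc 2 j))
    (tree-induction _ step)
  where
  room : M + 7 + 2 * (2 + 2 * j) ≤ Δ
  room = subst (λ h → M + 7 + 2 * h ≤ Δ) (*-suc 2 j) room₁

  room′ : M + 7 + 2 * (2 * j) ≤ Δ
  room′ = ≤-trans (+-monoʳ-≤ (M + 7) (*-monoʳ-≤ 2 (m≤n+m (2 * j) 2))) room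

  step : ∀ ts →
    (∀ i → size (lookup ts i) < M ^ suc j →
      WeakNeck Δ (2 + 2 * j) (lookup ts i) × WeakHead Δ (2 + 2 * j) (lookup ts i)) →
    size (node ts) < M ^ suc j → WeakNeck Δ (2 + 2 * j) (node ts) × WeakHead Δ (2 + 2 * j) (node ts)
  step ts rec size< = weakNeck , weakHead
    where
    sizes< : sizes ts < M ^ suc j
    sizes< = ≤-<-trans (n≤1+n _) size<
    child< : ∀ i → size (lookup ts i) < M ^ suc j
    child< i = ≤-<-trans (size-lookup ts i) sizes<
    open Relabelling Δ (2 * j) M (M ^ j) ts room
      -- Heavy branches have at least M^j vertices each and fewer than M * M^j together, so there
      -- are fewer than M.
      (λ ℓ → *-cancelʳ-< (M ^ j) _ _ (≤-<-trans (length-heavyLabels (M ^ j) ts ℓ) sizes<))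
      (λ i → proj₁ (rec i (child< i))) (λ i → proj₂ (rec i (child< i)))
      (λ i light → proj₁ (small⇒weak j room′ (lookup ts i) light))

Compat : ℕ → Tree → ℕ → Set
Compat Δ t h = HeadCompat Δ t h × NeckCompat Δ t h

-- In L_{h′} both labels lie in L_h and in L_{h+1}, so the one-sided transfer applies in both
-- directions.
weak⇒compat : ∀ {h h′} → suc h ≤ h′ → WeakNeck Δ h t × WeakHead Δ h t → Compat Δ t h′
weak⇒compat {Δ} {t} {h} {h′} h<h′ (neck , head) = headCompat , neckCompat
  where
  outer : ∀ {x} → InL Δ h′ x → InL Δ h x
  outer = InL-antitone (≤-trans (n≤1+n h) h<h′)
  inner : ∀ {x} → InL Δ h′ x → InL Δ (suc h) x
  inner = InL-antitone h<h′
  headCompat : HeadCompat Δ t h′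
  headCompat a a′ b a∈ a′∈ _ a-b a′-b = mk⇔
    (Ext⇒δ t ∘ head (outer a∈) (inner a′∈) a′-b ∘ δ⇒Ext t)
    (Ext⇒δ t ∘ head (outer a′∈) (inner a∈) a-b ∘ δ⇒Ext t)
  neckCompat : NeckCompat Δ t h′
  neckCompat a b b′ _ b∈ b′∈ a-b a-b′ = mk⇔
    (Ext⇒δ t ∘ neck (outer b∈) (inner b′∈) a-b′ ∘ δ⇒Ext t)
    (Ext⇒δ t ∘ neck (outer b′∈) (inner b∈) a-b ∘ δ⇒Ext t)

-- Degrees, sizes and the bound on the level

0<size : ∀ t → 0 < size t
0<size (node ts) = s≤s z≤n

length≤sizes : ∀ ts → length ts ≤ sizes ts
length≤sizes []              = z≤n
length≤sizes (node us ∷ ts) = s≤s (≤-trans (length≤sizes ts) (m≤n+m (sizes ts) (sizes us)))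

-- Strictness pays for the edge to the parent in the degree of a non-root vertex.
arity<size : ∀ {t} (p : Pos t) → arity p < size t
arity<size (here {ts})     = s≤s (length≤sizes ts)
arity<size (into {ts} i p) = ≤-trans (arity<size p) (≤-trans (size-lookup ts i) (n≤1+n _))

deg≤size : ∀ {t} (p : Pos t) → deg p ≤ size t
deg≤size (here {ts})     = ≤-trans (length≤sizes ts) (n≤1+n _)
deg≤size (into {ts} i p) = ≤-trans (arity<size p) (≤-trans (size-lookup ts i) (n≤1+n _))

^-mono : ∀ {m n o p} .{{_ : NonZero n}} → m ≤ n → o ≤ p → m ^ o ≤ n ^ p
^-mono {n = n} {o} m≤n o≤p = ≤-trans (^-monoˡ-≤ o m≤n) (^-monoʳ-≤ n o≤p)

-- With j = ⌊(h+1)/16⌋ and M = Δ - 7 - 4j, nonemptiness of L_h makes Δ ≥ 32j - 3, so Δ ≤ 2M ≤ M².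
level-bound : ∀ {Δ t h x} → 2 ≤ Δ → Δ ≤ size t → InL Δ h x →
  Δ ^ suc h ≤ size t ^ 64 ⊎ Compat Δ t h
level-bound {Δ} {t} {h} {x} 2≤Δ Δ≤size x∈ = cases (suc h / 16) _ (m≡m%n+[m/n]*n (suc h) 16) (s≤s⁻¹ (m%n<n (suc h) 16))
  where
  open ≤-Reasoning
  instance
    Δ≢0 : NonZero Δ
    Δ≢0 = >-nonZero (≤-trans (s≤s z≤n) 2≤Δ)
    size≢0 : NonZero (size t)
    size≢0 = >-nonZero (≤-trans (≤-trans (s≤s z≤n) 2≤Δ) Δ≤size)

  2h≤ : h + h ≤ suc Δ
  2h≤ = ≤-trans (+-monoʳ-≤ h (proj₁ x∈)) (InL⇒+≤ x∈)

  cases : ∀ j r → suc h ≡ r + j * 16 → r ≤ 15 → Δ ^ suc h ≤ size t ^ 64 ⊎ Compat Δ t h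
  cases zero r eq r≤ = inj₁ (^-mono Δ≤size (begin
    suc h       ≡⟨ trans eq (+-identityʳ r) ⟩
    r           ≤⟨ r≤ ⟩
    15          ≤⟨ m≤m+n 15 49 ⟩
    64          ∎))
  cases (suc i) r eq r≤ = by-size (M ^ j ≤? size t)
    where
    j = suc i
    M = Δ ∸ (7 + 4 * j)

    32j≤Δ+3 : 32 * j ≤ 3 + Δ
    32j≤Δ+3 = begin
      32 * j                  ≡⟨ lemma j ⟩
      j * 16 + j * 16         ≤⟨ +-mono-≤ (m≤n+m (j * 16) r) (m≤n+m (j * 16) r) ⟩
      (r + j * 16) + (r + j * 16) ≡⟨ cong₂ _+_ eq eq ⟨
      suc h + suc h           ≡⟨ cong suc (+-suc h h) ⟩
      2 + (h + h)             ≤⟨ +-monoʳ-≤ 2 2h≤ ⟩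
      3 + Δ                   ∎
      where
      lemma : ∀ j → 32 * j ≡ j * 16 + j * 16
      lemma = solve-∀

    14+8j≤Δ : 14 + 8 * j ≤ Δ
    14+8j≤Δ = +-cancelˡ-≤ 3 _ _ (begin
      3 + (14 + 8 * j)  ≤⟨ m≤m+n _ (7 + 24 * i) ⟩
      3 + (14 + 8 * j) + (7 + 24 * i) ≡⟨ lemma i ⟩
      32 * j            ≤⟨ 32j≤Δ+3 ⟩
      3 + Δ             ∎)
      where
      lemma : ∀ i → 3 + (14 + 8 * suc i) + (7 + 24 * i) ≡ 32 * suc i
      lemma = solve-∀

    M-spec : M + (7 + 4 * j) ≡ Δ
    M-spec = m∸n+n≡m (≤-trans (+-mono-≤ (m≤m+n 7 7) (*-monoˡ-≤ j (m≤m+n 4 4))) 14+8j≤Δ)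

    7+4j≤M : 7 + 4 * j ≤ M
    7+4j≤M = +-cancelʳ-≤ (7 + 4 * j) _ _ (begin
      7 + 4 * j + (7 + 4 * j) ≡⟨ lemma j ⟩
      14 + 8 * j              ≤⟨ 14+8j≤Δ ⟩
      Δ                       ≡⟨ M-spec ⟨
      M + (7 + 4 * j)         ∎)
      where
      lemma : ∀ j → 7 + 4 * j + (7 + 4 * j) ≡ 14 + 8 * j
      lemma = solve-∀

    Δ≤M² : Δ ≤ M ^ 2
    Δ≤M² = begin
      Δ               ≡⟨ M-spec ⟨
      M + (7 + 4 * j) ≤⟨ +-monoʳ-≤ M 7+4j≤M ⟩
      M + M           ≡⟨ cong (M +_) (+-identityʳ M) ⟨
      2 * M           ≤⟨ *-monoˡ-≤ M (≤-trans (m≤m+n 2 (5 + 4 * j)) 7+4j≤M) ⟩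
      M * M           ≡⟨ cong (M *_) (*-identityʳ M) ⟨
      M ^ 2           ∎

    room : M + 7 + 2 * (2 * j) ≤ Δ
    room = ≤-reflexive (trans (lemma M j) M-spec)
      where
      lemma : ∀ M j → M + 7 + 2 * (2 * j) ≡ M + (7 + 4 * j)
      lemma = solve-∀

    2j<h : suc (2 * j) ≤ h
    2j<h = s≤s⁻¹ (begin
      suc (suc (2 * j))             ≤⟨ m≤m+n _ (12 + 14 * i) ⟩
      suc (suc (2 * j)) + (12 + 14 * i) ≡⟨ lemma i ⟩
      j * 16                        ≤⟨ m≤n+m (j * 16) r ⟩
      r + j * 16                    ≡⟨ eq ⟨
      suc h                         ∎)
      where
      lemma : ∀ i → suc (suc (2 * suc i)) + (12 + 14 * i) ≡ suc i * 16
      lemma = solve-∀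

    suc-h≤32j : suc h ≤ 32 * j
    suc-h≤32j = begin
      suc h            ≡⟨ eq ⟩
      r + j * 16       ≤⟨ +-monoˡ-≤ (j * 16) r≤ ⟩
      15 + j * 16      ≤⟨ m≤m+n _ (1 + 16 * i) ⟩
      15 + j * 16 + (1 + 16 * i) ≡⟨ lemma i ⟩
      32 * j           ∎
      where
      lemma : ∀ i → 15 + suc i * 16 + (1 + 16 * i) ≡ 32 * suc i
      lemma = solve-∀

    by-size : Dec (M ^ j ≤ size t) → Δ ^ suc h ≤ size t ^ 64 ⊎ Compat Δ t h
    by-size (no  M^j≰) = inj₂ (weak⇒compat 2j<h (small⇒weak j room t (≰⇒> M^j≰)))
    -- Source of 64: h + 1 is at most 32j because r ≤ 15 and j ≥ 1, and replacing Δ by M² doubles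
    -- the exponent.
    by-size (yes M^j≤) = inj₁ (begin
      Δ ^ suc h         ≤⟨ ^-monoʳ-≤ Δ suc-h≤32j ⟩
      Δ ^ (32 * j)      ≤⟨ ^-monoˡ-≤ (32 * j) Δ≤M² ⟩
      (M ^ 2) ^ (32 * j) ≡⟨ ^-*-assoc M 2 (32 * j) ⟩
      M ^ (2 * (32 * j)) ≡⟨ cong (M ^_) (lemma j) ⟩
      M ^ (j * 64)      ≡⟨ ^-*-assoc M j 64 ⟨
      (M ^ j) ^ 64      ≤⟨ ^-monoˡ-≤ 64 M^j≤ ⟩
      size t ^ 64       ∎)
      where
      lemma : ∀ j → 2 * (32 * j) ≡ j * 64
      lemma = solve-∀

theorem3p3 : Σ ℕ λ C → ∀ (Δ : ℕ) (t : Tree) → 2 ≤ Δ → MaxDegree t Δ →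
    ∀ (h : ℕ) →
    (HeadLevel Δ t h → Δ ^ h ≤ size t ^ C) ×
    (NeckLevel Δ t h → Δ ^ h ≤ size t ^ C)
-- In logarithms, with Δ ≥ 2, the inequality reads h ≤ 64 log n / log Δ for n vertices.
theorem3p3 = 64 , bounds
  where
  bounds : ∀ Δ t → 2 ≤ Δ → MaxDegree t Δ → ∀ h →
    (HeadLevel Δ t h → Δ ^ h ≤ size t ^ 64) × (NeckLevel Δ t h → Δ ^ h ≤ size t ^ 64)
  bounds Δ t 2≤Δ _ zero = (λ _ → 1≤) , (λ _ → 1≤)
    where
    1≤ : 1 ≤ size t ^ 64
    1≤ = subst (_≤ size t ^ 64) (^-zeroˡ 64) (^-monoˡ-≤ 64 (0<size t))
  bounds Δ t 2≤Δ (_ , p , deg≡Δ) (suc h) =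
    -- The goal is decidable, so its failure may be assumed and L_h-compatibility derived. The label
    -- given there shows that L_h is nonempty, as `level-bound` requires.
    (λ (¬compat , _) → decidable-stable (_ ≤? _) λ ≰ → ¬compat λ a a′ b a∈ →
      proj₁ (compat ≰ a∈) a a′ b a∈) ,
    (λ (¬compat , _) → decidable-stable (_ ≤? _) λ ≰ → ¬compat λ a b b′ a∈ b∈ →
      proj₂ (compat ≰ b∈) a b b′ a∈ b∈)
    where
    compat : ∀ {x} → ¬ (Δ ^ suc h ≤ size t ^ 64) → InL Δ h x → Compat Δ t h
    compat ≰ x∈ with level-bound {t = t} 2≤Δ (subst (_≤ size t) deg≡Δ (deg≤size p)) x∈
    ... | inj₁ bound  = ⊥-elim (≰ bound)
    ... | inj₂ compat = compat
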